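{- Let $k\ge 2$ and $P=\{A^k+B^k\mid A,B\in M_2(\mathbb F_3)\}$. Let $C_5$ be the set of nonzero nilpotent matrices in $M_2(\mathbb F_3)$ (the conjugacy class of $\begin{pmatrix}0&1\\0&0\end{pmatrix}$), and let $C_9,C_{10},C_{12}$ be the conjugacy classes in $M_2(\mathbb F_3)$ of $\begin{pmatrix}2&1\\0&2\end{pmatrix}$, $\begin{pmatrix}0&2\\1&0\end{pmatrix}$, $\begin{pmatrix}0&1\\1&1\end{pmatrix}$ respectively. Then $P=M_2(\mathbb F_3)$ if $k\not\equiv 0,6,12,18\pmod{24}$; $P=M_2(\mathbb F_3)\setminus C_5$ if $k\equiv 6$ or $18\pmod{24}$; and $P=M_2(\mathbb F_3)\setminus(C_5\cup C_9\cup C_{10}\cup C_{12})$ if $k\equiv 0\pmod{12}$. -}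

module Defs where

open import Data.Nat using (ℕ; zero; suc)
open import Data.Product using (∃; ∃-syntax; _×_)
open import Data.Sum using (_⊎_)
open import Relation.Binary.PropositionalEquality using (_≡_)
open import Relation.Nullary using (¬_)

data F3 : Set where
  f0 f1 f2 : F3

infixl 6 _+₃_
infixl 7 _*₃_

_+₃_ : F3 → F3 → F3
f0 +₃ y = y
f1 +₃ f0 = f1
f1 +₃ f1 = f2
f1 +₃ f2 = f0
f2 +₃ f0 = f2
f2 +₃ f1 = f0
f2 +₃ f2 = f1

_*₃_ : F3 → F3 → F3
f0 *₃ y = f0
f1 *₃ y = y
f2 *₃ f0 = f0
f2 *₃ f1 = f2
f2 *₃ f2 = f1

record M2 : Set where
  constructor mat
  field
    a b c d : F3

open M2 public

infixl 6 _⊕_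
infixl 7 _⊗_

_⊕_ : M2 → M2 → M2
mat a₁ b₁ c₁ d₁ ⊕ mat a₂ b₂ c₂ d₂ = mat (a₁ +₃ a₂) (b₁ +₃ b₂) (c₁ +₃ c₂) (d₁ +₃ d₂)

_⊗_ : M2 → M2 → M2
mat a₁ b₁ c₁ d₁ ⊗ mat a₂ b₂ c₂ d₂ =
  mat (a₁ *₃ a₂ +₃ b₁ *₃ c₂) (a₁ *₃ b₂ +₃ b₁ *₃ d₂)
      (c₁ *₃ a₂ +₃ d₁ *₃ c₂) (c₁ *₃ b₂ +₃ d₁ *₃ d₂)

I₂ : M2
I₂ = mat f1 f0 f0 f1

O₂ : M2
O₂ = mat f0 f0 f0 f0

_^ᴹ_ : M2 → ℕ → M2
A ^ᴹ zero = I₂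
A ^ᴹ suc k = A ⊗ (A ^ᴹ k)

InP : ℕ → M2 → Set
InP k X = ∃[ A ] ∃[ B ] (A ^ᴹ k ⊕ B ^ᴹ k ≡ X)

Conj : M2 → M2 → Set
Conj X Y = ∃[ S ] ∃[ T ] ((S ⊗ T ≡ I₂) × (T ⊗ S ≡ I₂) × (X ≡ S ⊗ Y ⊗ T))

InC5 : M2 → Set
InC5 X = ¬ (X ≡ O₂) × ∃[ n ] (X ^ᴹ n ≡ O₂)

InC9 InC10 InC12 : M2 → Set
InC9  X = Conj X (mat f2 f1 f0 f2)
InC10 X = Conj X (mat f0 f2 f1 f0)
InC12 X = Conj X (mat f0 f1 f1 f1)

{-# OPTIONS --safe #-}
module Submission where

-- For k ≥ 2 the power A^k depends only on k mod 24: 24 is the exponent of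
-- GL₂(F₃), and singular matrices satisfy A² = tr(A) A. This leaves the 24
-- exponents 2, …, 25, for which P is computed from the list of distinct k-th
-- powers. The excluded classes consist of nonscalar matrices, and a similarity
-- class of nonscalar 2×2 matrices is determined by its trace and determinant.

open import Defs
open import Data.Fin using (Fin; toℕ)
import Data.Fin.Properties as Fin
open import Data.List using (List; []; _∷_; map; deduplicate; cartesianProduct; cartesianProductWith)
open import Data.List.Membership.Propositional using (_∈_; find; lose)
open import Data.List.Membership.Propositional.Properties using (∈-map⁺; ∈-map⁻; ∈-deduplicate⁺; ∈-deduplicate⁻; ∈-cartesianProduct⁺; ∈-cartesianProductWith⁺)
open import Data.List.Relation.Unary.All as All using ()
open import Data.List.Relation.Unary.Any as Any using (Any; here; there)
open import Data.Nat using (ℕ; zero; suc; _+_; _*_; _≤_; _%_; z≤n; s≤s; NonZero)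
import Data.Nat.Properties as ℕ
open import Data.Nat.DivMod using (_divMod_; result; %-remove-+ʳ)
open import Data.Nat.Divisibility using (_∣_; divides; ∣-refl; ∣n⇒∣m*n)
open import Data.Nat.Tactic.RingSolver using (solve-∀)
open import Data.Product using (_×_; _,_; proj₁; proj₂; ∃-syntax)
open import Data.Sum using (_⊎_)
open import Data.Sum.Function.Propositional using (_⊎-⇔_)
open import Data.Unit using (⊤; tt)
open import Function using (_∘_)
open import Relation.Binary using (DecidableEquality)
open import Relation.Binary.PropositionalEquality using (_≡_; refl; sym; trans; cong; cong₂; subst)
open import Relation.Nullary using (¬_; Dec; yes; no)
open import Relation.Nullary.Decidable using (map′; ¬?; _×-dec_; _⊎-dec_; _→-dec_; from-yes)
open import Relation.Unary using (Pred; Decidable)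
open import Function.Bundles using (_⇔_; mk⇔; Equivalence)
open import Function.Properties.Equivalence using () renaming (trans to ⇔-trans)
open import Level using (0ℓ)

-- Deciding statements over F₃ and M₂(F₃) by enumeration.

infix 4 _≟₃_ _≟ᴹ_

_≟₃_ : DecidableEquality F3
f0 ≟₃ f0 = yes refl
f0 ≟₃ f1 = no λ ()
f0 ≟₃ f2 = no λ ()
f1 ≟₃ f0 = no λ ()
f1 ≟₃ f1 = yes refl
f1 ≟₃ f2 = no λ ()
f2 ≟₃ f0 = no λ ()
f2 ≟₃ f1 = no λ ()
f2 ≟₃ f2 = yes refl

_≟ᴹ_ : DecidableEquality M2
mat a b c d ≟ᴹ mat a′ b′ c′ d′ =
  map′ (λ { (refl , refl , refl , refl) → refl })
       (λ { refl → refl , refl , refl , refl })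
       ((a ≟₃ a′) ×-dec (b ≟₃ b′) ×-dec (c ≟₃ c′) ×-dec (d ≟₃ d′))

scalars : List F3
scalars = f0 ∷ f1 ∷ f2 ∷ []

∈-scalars : ∀ x → x ∈ scalars
∈-scalars f0 = here refl
∈-scalars f1 = there (here refl)
∈-scalars f2 = there (there (here refl))

matrices : List M2
matrices = cartesianProductWith (λ (a , b) (c , d) → mat a b c d)
             (cartesianProduct scalars scalars) (cartesianProduct scalars scalars)

∈-matrices : ∀ X → X ∈ matrices
∈-matrices (mat a b c d) =
  ∈-cartesianProductWith⁺ (λ (a , b) (c , d) → mat a b c d)
    (∈-cartesianProduct⁺ (∈-scalars a) (∈-scalars b))
    (∈-cartesianProduct⁺ (∈-scalars c) (∈-scalars d))

module _ {P : Pred M2 0ℓ} where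

  ∀ᴹ? : Decidable P → Dec (∀ X → P X)
  ∀ᴹ? P? = map′ (λ all X → All.lookup all (∈-matrices X))
                (λ all → All.universal all matrices)
                (All.all? P? matrices)

  ∃ᴹ? : Decidable P → Dec (∃[ X ] P X)
  ∃ᴹ? P? = map′ Any.satisfied (λ (X , p) → lose (∈-matrices X) p)
                (Any.any? P? matrices)

-- Periodicity of powers.

module _ (A : M2) where

  ^ᴹ-shift : ∀ {m n} → A ^ᴹ m ≡ A ^ᴹ n → ∀ j → A ^ᴹ (j + m) ≡ A ^ᴹ (j + n)
  ^ᴹ-shift eq zero = eq
  ^ᴹ-shift eq (suc j) = cong (A ⊗_) (^ᴹ-shift eq j)

  ^ᴹ-periods : ∀ {p m} → A ^ᴹ (p + m) ≡ A ^ᴹ m → ∀ q → A ^ᴹ (q * p + m) ≡ A ^ᴹ m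
  ^ᴹ-periods eq zero = refl
  ^ᴹ-periods {p} {m} eq (suc q) =
    trans (cong (A ^ᴹ_) (ℕ.+-assoc p (q * p) m))
          (trans (^ᴹ-shift (^ᴹ-periods eq q) p) eq)

  -- With n in place of a literal exponent, no use of this lemma makes
  -- the type checker expand A²⁶ for a variable matrix A.
  ^ᴹ-26≡^ᴹ-2 : ∀ {n} → n ≡ 26 → A ^ᴹ n ≡ A ^ᴹ 2
  ^ᴹ-26≡^ᴹ-2 refl = from-yes (∀ᴹ? λ X → X ^ᴹ 26 ≟ᴹ X ^ᴹ 2) A

  -- The base exponent cannot be lowered to 1: a nonzero nilpotent A has A²⁵ = 0.
  ^ᴹ-mod-24 : ∀ q → A ^ᴹ (q * 24 + 2) ≡ A ^ᴹ 2
  ^ᴹ-mod-24 = ^ᴹ-periods (^ᴹ-26≡^ᴹ-2 refl)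

InP-cong : ∀ k m {X} → (∀ A → A ^ᴹ k ≡ A ^ᴹ m) → InP k X → InP m X
InP-cong k m k≗m (A , B , eq) = A , B , trans (sym (cong₂ _⊕_ (k≗m A) (k≗m B))) eq

-- Similarity classes by trace and determinant.

tr det : M2 → F3
tr (mat a b c d) = a +₃ d
det (mat a b c d) = a *₃ d +₃ f2 *₃ (b *₃ c)

-- In F₃ the determinant of an invertible matrix is its own inverse.
inverse : M2 → M2
inverse S@(mat a b c d) = mat (det S *₃ d) (neg *₃ b) (neg *₃ c) (det S *₃ a)
  where neg = f2 *₃ det S

Scalar : Pred M2 0ℓ
Scalar (mat a b c d) = b ≡ f0 × c ≡ f0 × a ≡ d

scalar? : Decidable Scalar
scalar? (mat a b c d) = (b ≟₃ f0) ×-dec (c ≟₃ f0) ×-dec (a ≟₃ d)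

-- Decidable substitute for the four classes, whose definitions involve an unbounded exponent or a
-- conjugating pair.
Nonscalar : F3 → F3 → Pred M2 0ℓ
Nonscalar t δ X = tr X ≡ t × det X ≡ δ × ¬ Scalar X

nonscalar? : ∀ t δ → Decidable (Nonscalar t δ)
nonscalar? t δ X = (tr X ≟₃ t) ×-dec (det X ≟₃ δ) ×-dec ¬? (scalar? X)

^ᴹ-zero-+ : ∀ X m n → X ^ᴹ n ≡ O₂ → X ^ᴹ (m + n) ≡ O₂
^ᴹ-zero-+ X zero n eq = eq
^ᴹ-zero-+ X (suc m) n eq rewrite ^ᴹ-zero-+ X m n eq =
  from-yes (∀ᴹ? λ X → X ⊗ O₂ ≟ᴹ O₂) X

-- Raising the exponent from n to 24n + 2 keeps the power zero, and periodicity then brings it down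
-- to 2.
nilpotent⇒square-zero : ∀ X n → X ^ᴹ n ≡ O₂ → X ^ᴹ 2 ≡ O₂
nilpotent⇒square-zero X n eq =
  trans (sym (^ᴹ-mod-24 X n))
        (subst (λ m → X ^ᴹ m ≡ O₂) (index n) (^ᴹ-zero-+ X (2 + n * 23) n eq))
  where
  index : ∀ n → 2 + n * 23 + n ≡ n * 24 + 2
  index = solve-∀

InC5⇔ : ∀ X → InC5 X ⇔ Nonscalar f0 f0 X
InC5⇔ X = mk⇔ to (λ p → let X≢0 , X²≡0 = from p in X≢0 , 2 , X²≡0)
  where
  square-zero : ∀ X → ¬ X ≡ O₂ → X ^ᴹ 2 ≡ O₂ → Nonscalar f0 f0 X
  square-zero = from-yes (∀ᴹ? λ X → ¬? (X ≟ᴹ O₂) →-dec (X ^ᴹ 2 ≟ᴹ O₂) →-dec nonscalar? f0 f0 X)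

  from : Nonscalar f0 f0 X → ¬ X ≡ O₂ × X ^ᴹ 2 ≡ O₂
  from = from-yes (∀ᴹ? λ X → nonscalar? f0 f0 X →-dec (¬? (X ≟ᴹ O₂) ×-dec (X ^ᴹ 2 ≟ᴹ O₂))) X

  to : InC5 X → Nonscalar f0 f0 X
  to (X≢0 , n , eq) = square-zero X X≢0 (nilpotent⇒square-zero X n eq)

-- Makes the second conjugating matrix a function of the first, so the class checks search over S
-- alone.
right-inverse-unique : ∀ S T → S ⊗ T ≡ I₂ → T ≡ inverse S
right-inverse-unique = from-yes (∀ᴹ? λ S → ∀ᴹ? λ T → (S ⊗ T ≟ᴹ I₂) →-dec (T ≟ᴹ inverse S))

-- For singular S the matrix `inverse S` is zero, so `S ⊗ inverse S ≡ I₂` singles out the invertible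
-- S.
IsClassOf : M2 → F3 → F3 → Set
IsClassOf Y t δ =
  (∀ S → S ⊗ inverse S ≡ I₂ → Nonscalar t δ (S ⊗ Y ⊗ inverse S)) ×
  (∀ X → Nonscalar t δ X →
    ∃[ S ] (S ⊗ inverse S ≡ I₂ × inverse S ⊗ S ≡ I₂ × X ≡ S ⊗ Y ⊗ inverse S))

isClassOf? : ∀ Y t δ → Dec (IsClassOf Y t δ)
isClassOf? Y t δ =
  (∀ᴹ? λ S → (S ⊗ inverse S ≟ᴹ I₂) →-dec nonscalar? t δ (S ⊗ Y ⊗ inverse S)) ×-dec
  (∀ᴹ? λ X → nonscalar? t δ X →-dec
    ∃ᴹ? λ S → (S ⊗ inverse S ≟ᴹ I₂) ×-dec (inverse S ⊗ S ≟ᴹ I₂) ×-dec (X ≟ᴹ S ⊗ Y ⊗ inverse S))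

Conj⇔ : ∀ Y t δ → IsClassOf Y t δ → ∀ X → Conj X Y ⇔ Nonscalar t δ X
Conj⇔ Y t δ (to , from) X = mk⇔ to′ from′
  where
  to′ : Conj X Y → Nonscalar t δ X
  to′ (S , T , ST≡I , _ , X≡SYT) =
    subst (Nonscalar t δ) (sym (trans X≡SYT (cong (S ⊗ Y ⊗_) T≡S⁻¹)))
      (to S (subst (λ T → S ⊗ T ≡ I₂) T≡S⁻¹ ST≡I))
    where T≡S⁻¹ = right-inverse-unique S T ST≡I

  from′ : Nonscalar t δ X → Conj X Y
  from′ p = let S , q = from X p in S , inverse S , q

-- The parameters are read off the representative: its characteristic polynomial is x² - x + 1 = (x
-- + 1)². For C₁₀ and C₁₂ below it is x² + 1 and x² - x - 1, both irreducible.
InC9⇔ : ∀ X → InC9 X ⇔ Nonscalar f1 f1 X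
InC9⇔ = Conj⇔ Y f1 f1 (from-yes (isClassOf? Y f1 f1))
  where Y = mat f2 f1 f0 f2

InC10⇔ : ∀ X → InC10 X ⇔ Nonscalar f0 f1 X
InC10⇔ = Conj⇔ Y f0 f1 (from-yes (isClassOf? Y f0 f1))
  where Y = mat f0 f2 f1 f0

InC12⇔ : ∀ X → InC12 X ⇔ Nonscalar f1 f2 X
InC12⇔ = Conj⇔ Y f1 f2 (from-yes (isClassOf? Y f1 f2))
  where Y = mat f0 f1 f1 f1

-- Sums of two k-th powers.

powers : ℕ → List M2
-- Dropping repetitions shortens the later search, which is quadratic in the length of this list.
powers k = deduplicate _≟ᴹ_ (map (_^ᴹ k) matrices)

∈-powers⁺ : ∀ k A → A ^ᴹ k ∈ powers k
∈-powers⁺ k A = ∈-deduplicate⁺ _≟ᴹ_ (∈-map⁺ (_^ᴹ k) (∈-matrices A))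

∈-powers⁻ : ∀ k {Y} → Y ∈ powers k → ∃[ A ] A ^ᴹ k ≡ Y
∈-powers⁻ k Y∈ =
  let A , _ , eq = ∈-map⁻ (_^ᴹ k) {xs = matrices} (∈-deduplicate⁻ _≟ᴹ_ (map (_^ᴹ k) matrices) Y∈)
  in A , sym eq

SumFrom : List M2 → Pred M2 0ℓ
SumFrom Ys X = Any (λ Y → Any (λ Z → Y ⊕ Z ≡ X) Ys) Ys

SumFrom-powers⇔InP : ∀ k X → SumFrom (powers k) X ⇔ InP k X
SumFrom-powers⇔InP k X = mk⇔ to from
  where
  to : SumFrom (powers k) X → InP k X
  to s with Y , Y∈ , t ← find s with Z , Z∈ , eq ← find t =
    let A , A^k≡Y = ∈-powers⁻ k Y∈
        B , B^k≡Z = ∈-powers⁻ k Z∈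
    in A , B , trans (cong₂ _⊕_ A^k≡Y B^k≡Z) eq

  from : InP k X → SumFrom (powers k) X
  from (A , B , eq) = lose (∈-powers⁺ k A) (lose (∈-powers⁺ k B) eq)

SumsAre : Pred M2 0ℓ → List M2 → Set
SumsAre Q Ys = ∀ X → (SumFrom Ys X → Q X) × (Q X → SumFrom Ys X)

sumsAre? : ∀ {Q} → Decidable Q → Decidable (SumsAre Q)
sumsAre? Q? Ys = ∀ᴹ? λ X → (sumFrom? X →-dec Q? X) ×-dec (Q? X →-dec sumFrom? X)
  where
  sumFrom? : Decidable (SumFrom Ys)
  sumFrom? X = Any.any? (λ Y → Any.any? (λ Z → Y ⊕ Z ≟ᴹ X) Ys) Ys

-- Reduction to the exponents 2, ..., 25.

PIs : ℕ → Pred M2 0ℓ → Set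
PIs k Q = ∀ X → InP k X ⇔ Q X

SumsAre-powers⇒PIs : ∀ k m {Q} → (∀ A → A ^ᴹ k ≡ A ^ᴹ m) → SumsAre Q (powers m) → PIs k Q
SumsAre-powers⇒PIs k m k≗m sums X = mk⇔
  (λ p → proj₁ (sums X) (from (InP-cong k m k≗m p)))
  (λ q → InP-cong m k (λ A → sym (k≗m A)) (to (proj₂ (sums X) q)))
  where open Equivalence (SumFrom-powers⇔InP m X)

module _ (n : ℕ) .{{_ : NonZero n}} (n∣24 : n ∣ 24) (C : Pred ℕ 0ℓ) (Q : Pred M2 0ℓ) where

  -- The shift by 2 gives one exponent per residue mod 24, starting where periodicity does. Since n
  -- divides 24, the condition on k mod n can be tested on that exponent.
  SmallExponents : Set
  SmallExponents = ∀ (r : Fin 24) → C ((toℕ r + 2) % n) → SumsAre Q (powers (toℕ r + 2))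

  smallExponents? : Decidable C → Decidable Q → Dec SmallExponents
  smallExponents? C? Q? = Fin.all? λ r → C? ((toℕ r + 2) % n) →-dec sumsAre? Q? (powers (toℕ r + 2))

  allExponents : SmallExponents → ∀ k → 2 ≤ k → C (k % n) → PIs k Q
  allExponents small (suc (suc j)) (s≤s (s≤s z≤n)) c with result q r j≡ ← j divMod 24 =
    SumsAre-powers⇒PIs (2 + j) (toℕ r + 2) k≗r+2 (small r (subst C k%n≡ c))
    where
    k≡ : 2 + j ≡ toℕ r + 2 + q * 24
    k≡ = trans (cong (2 +_) j≡) (cong (_+ q * 24) (ℕ.+-comm 2 (toℕ r)))

    k%n≡ : (2 + j) % n ≡ (toℕ r + 2) % n
    k%n≡ = trans (cong (_% n) k≡) (%-remove-+ʳ (toℕ r + 2) (∣n⇒∣m*n q n∣24))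

    k≗r+2 : ∀ A → A ^ᴹ (2 + j) ≡ A ^ᴹ (toℕ r + 2)
    k≗r+2 A = trans
      (cong (A ^ᴹ_) (trans k≡ (trans (ℕ.+-assoc (toℕ r) 2 (q * 24)) (cong (toℕ r +_) (ℕ.+-comm 2 (q * 24))))))
      (^ᴹ-shift A (^ᴹ-mod-24 A q) (toℕ r))

-- The three cases of the theorem.

Exceptional : Pred ℕ 0ℓ
Exceptional i = i ≡ 0 ⊎ i ≡ 6 ⊎ i ≡ 12 ⊎ i ≡ 18

C5∪C9∪C10∪C12 : Pred M2 0ℓ
C5∪C9∪C10∪C12 X =
  Nonscalar f0 f0 X ⊎ Nonscalar f1 f1 X ⊎ Nonscalar f0 f1 X ⊎ Nonscalar f1 f2 X

abstract

  generic : SmallExponents 24 ∣-refl (¬_ ∘ Exceptional) (λ _ → ⊤)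
  generic = from-yes (smallExponents? 24 ∣-refl (¬_ ∘ Exceptional) (λ _ → ⊤)
    (λ i → ¬? ((i ℕ.≟ 0) ⊎-dec (i ℕ.≟ 6) ⊎-dec (i ℕ.≟ 12) ⊎-dec (i ℕ.≟ 18)))
    (λ _ → yes tt))

  -- Behind the enumeration: the k-th powers are 0, ±I, the rank-one idempotents E and the elements
  -- J of order 4, which together with ±I form a quaternion group. The nonscalar sums of trace 0 are
  -- I + E, J, J + J = -J, and J + J′ with J, J′ anticommuting; all have nonzero determinant.
  six-mod-twelve : SmallExponents 24 ∣-refl (λ i → i ≡ 6 ⊎ i ≡ 18) (¬_ ∘ Nonscalar f0 f0)
  six-mod-twelve = from-yes (smallExponents? 24 ∣-refl (λ i → i ≡ 6 ⊎ i ≡ 18) (¬_ ∘ Nonscalar f0 f0)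
    (λ i → (i ℕ.≟ 6) ⊎-dec (i ℕ.≟ 18))
    (λ X → ¬? (nonscalar? f0 f0 X)))

  -- Now the k-th powers are 0, I, the rank-one idempotents E and, for k ≡ 12 mod 24, also -I. A
  -- nonscalar sum of trace 0 is I + E, of determinant 2; one of trace 1 is E, of determinant 0.
  -- This rules out all four classes.
  zero-mod-twelve : SmallExponents 12 (divides 2 refl) (_≡ 0) (¬_ ∘ C5∪C9∪C10∪C12)
  zero-mod-twelve = from-yes (smallExponents? 12 (divides 2 refl) (_≡ 0) (¬_ ∘ C5∪C9∪C10∪C12)
    (ℕ._≟ 0)
    (λ X → ¬? (nonscalar? f0 f0 X ⊎-dec nonscalar? f1 f1 X ⊎-dec nonscalar? f0 f1 X ⊎-dec nonscalar? f1 f2 X)))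

¬-cong-⇔ : ∀ {A B : Set} → A ⇔ B → (¬ B) ⇔ (¬ A)
¬-cong-⇔ A⇔B = mk⇔ (_∘ to) (_∘ from)
  where open Equivalence A⇔B

theorem7p2 : (k : ℕ) → 2 ≤ k →
    (¬ (k % 24 ≡ 0 ⊎ k % 24 ≡ 6 ⊎ k % 24 ≡ 12 ⊎ k % 24 ≡ 18) →
    (X : M2) → InP k X)
    × ((k % 24 ≡ 6 ⊎ k % 24 ≡ 18) →
    (X : M2) → InP k X ⇔ (¬ InC5 X))
    × (k % 12 ≡ 0 →
    (X : M2) → InP k X ⇔ (¬ (InC5 X ⊎ InC9 X ⊎ InC10 X ⊎ InC12 X)))
theorem7p2 k 2≤k =
    (λ k≢ X → Equivalence.from (allExponents 24 ∣-refl (¬_ ∘ Exceptional) (λ _ → ⊤) generic k 2≤k k≢ X) tt)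
  , (λ k≡ X → ⇔-trans
      (allExponents 24 ∣-refl (λ i → i ≡ 6 ⊎ i ≡ 18) (¬_ ∘ Nonscalar f0 f0) six-mod-twelve k 2≤k k≡ X)
      (¬-cong-⇔ (InC5⇔ X)))
  , (λ k≡ X → ⇔-trans
      (allExponents 12 (divides 2 refl) (_≡ 0) (¬_ ∘ C5∪C9∪C10∪C12) zero-mod-twelve k 2≤k k≡ X)
      (¬-cong-⇔ (InC5⇔ X ⊎-⇔ InC9⇔ X ⊎-⇔ InC10⇔ X ⊎-⇔ InC12⇔ X)))
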